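{- Every cubic (i.e., $3$-regular) graph is balanceable.
   Context: All graphs are finite, simple and undirected. A $2$-coloring of the edges of the complete graph $K_n$ is a map $\varphi: E(K_n)\to\{R,B\}$. Such a coloring contains a balanced copy of a graph $G$ if there is a subgraph of $K_n$ isomorphic to $G$ whose edge set $E$ can be partitioned into $E_1,E_2$ with $||E_1|-|E_2||\le 1$, $\varphi(e)=R$ for all $e\in E_1$ and $\varphi(e)=B$ for all $e\in E_2$. For a graph $G$ and positive integer $n$, $\mathrm{bal}(n,G)$ is the smallest integer, if it exists, satisfying $\mathrm{bal}(n,G)<\lfloor \frac12\binom n2\rfloor$ such that every $2$-coloring $\varphi$ of $E(K_n)$ with $|\varphi^{ -1}(R)|>\mathrm{bal}(n,G)$ and $|\varphi^{ -1}(B)|>\mathrm{bal}(n,G)$ contains a balanced copy of $G$. A graph $G$ is balanceable if there exists an integer $n_0$ such that $\mathrm{bal}(n,G)$ exists for every integer $n\ge n_0$. -}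

module Defs where

open import Data.Nat using (ℕ; zero; suc; _+_; _≤_; _<_; _<ᵇ_)
open import Data.Nat.DivMod using (_/_)
open import Data.Nat.Combinatorics using (_C_)
open import Data.Bool using (Bool; true; false; _∧_; if_then_else_)
open import Data.Fin using (Fin; toℕ)
import Data.Fin as F
open import Data.Product using (Σ; ∃; _×_; _,_)
open import Relation.Binary.PropositionalEquality using (_≡_)
open import Relation.Nullary using (¬_)
open import Function.Definitions using (Injective)

count : ∀ {m} → (Fin m → Bool) → ℕ
count {zero}  p = 0
count {suc m} p = (if p F.zero then 1 else 0) + count (λ i → p (F.suc i))

countPairs : ∀ {m} → (Fin m → Fin m → Bool) → ℕ
countPairs {m} p = sumOver (λ i → count (λ j → (toℕ i <ᵇ toℕ j) ∧ p i j))
  where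
  sumOver : ∀ {k} → (Fin k → ℕ) → ℕ
  sumOver {zero}  f = 0
  sumOver {suc k} f = f F.zero + sumOver (λ i → f (F.suc i))

record Graph : Set where
  field
    order  : ℕ
    adj    : Fin order → Fin order → Bool
    sym    : ∀ u v → adj u v ≡ adj v u
    irrefl : ∀ u → adj u u ≡ false

open Graph public

degree : (G : Graph) → Fin (order G) → ℕ
degree G v = count (adj G v)

Cubic : Graph → Set
Cubic G = ∀ v → degree G v ≡ 3

data Color : Set where
  R B : Color

isR : Color → Bool
isR R = true
isR B = false

isB : Color → Bool
isB R = false
isB B = true

-- 2-coloring of E(K_n): a symmetric colour assignment to pairs of
-- vertices (values on the diagonal are irrelevant)
record Coloring (n : ℕ) : Set where
  field
    col    : Fin n → Fin n → Color
    colSym : ∀ i j → col i j ≡ col j i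

open Coloring public

#R #B : ∀ {n} → Coloring n → ℕ
#R φ = countPairs (λ i j → isR (col φ i j))
#B φ = countPairs (λ i j → isB (col φ i j))

-- a balanced copy of G: an injective map f : V(G) → V(K_n) (its image
-- with the image edges is a subgraph of K_n isomorphic to G); the edge set
-- splits into red edges E₁ and blue edges E₂ with ||E₁| - |E₂|| ≤ 1.
HasBalancedCopy : ∀ {n} → Coloring n → Graph → Set
HasBalancedCopy {n} φ G =
  Σ (Fin (order G) → Fin n) λ f →
    Injective _≡_ _≡_ f ×
    (let r = countPairs (λ u v → adj G u v ∧ isR (col φ (f u) (f v)))
         b = countPairs (λ u v → adj G u v ∧ isB (col φ (f u) (f v)))
     in (r ≤ suc b) × (b ≤ suc r))

Works : ℕ → Graph → ℕ → Set
Works n G b = ∀ (φ : Coloring n) → b < #R φ → b < #B φ → HasBalancedCopy φ G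

-- the integer threshold -1 works: every colouring contains a balanced copy
WorksNeg : ℕ → Graph → Set
WorksNeg n G = ∀ (φ : Coloring n) → HasBalancedCopy φ G

-- bal(n,G) exists: the set of integers b < ⌊ C(n,2)/2 ⌋ that work has a
-- smallest element, i.e. it is nonempty and bounded below (the set is
-- upward closed, so it is bounded below iff -1 does not work).
BalExists : ℕ → Graph → Set
BalExists n G =
  (Σ ℕ λ b → (b < (n C 2) / 2) × Works n G b) × ¬ WorksNeg n G

Balanceable : Graph → Set
Balanceable G = ∃ λ n₀ → ∀ n → n₀ ≤ n → BalExists n G

{-# OPTIONS --safe #-}
module Submission where

-- If both colours have more than ⌊C(n,2)/2⌋ - 1 edges, then each colour class has about n²/4
-- edges, hence contains a large complete bipartite graph.  By Ramsey's theorem its two sides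
-- contain large monochromatic cliques.  So either there are two large cliques of one colour joined completely
-- by the other colour, or there are large cliques of both colours; in the second case the
-- edges between them can be made monochromatic by pigeonhole.  It remains to find a vertex
-- set S of G such that half of the edges cross S (first pattern), and half of the edges
-- meet S (second pattern).  A cubic graph has an even order, and an independent set of
-- order/4 vertices, found greedily, meets exactly half of the edges.  If the order is 2
-- modulo 4, the greedy choice starts from the two ends of an edge instead.

open import Defs hiding (sym)
open import Data.Bool using (Bool; true; false; _∧_; _∨_; _xor_; not; if_then_else_)
import Data.Bool as Bool
open import Data.Fin using (Fin; toℕ)
import Data.Fin as F
import Data.Fin.Properties as F
open import Data.List using (List; []; _∷_; length; filter; map; take; allFin; tabulate; lookup)
open import Data.List.Membership.Propositional using (_∈_)
open import Data.List.Membership.Propositional.Properties using (∈-lookup; ∈-filter⁻)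
open import Data.List.Properties using (filter-accept; filter-reject; length-take; map-tabulate; length-tabulate)
open import Data.List.Relation.Binary.Sublist.Propositional
  using (_⊆_; []; _∷_; _∷ʳ_; ⊆-refl; ⊆-trans; minimum) renaming (lookup to ⊆-lookup)
open import Data.List.Relation.Binary.Sublist.Propositional.Properties using (All-resp-⊆; filter-⊆; take-⊆)
open import Data.List.Relation.Unary.All as All using (All; []; _∷_)
open import Data.List.Relation.Unary.All.Properties using (all-filter)
open import Data.List.Relation.Unary.AllPairs using (AllPairs; []; _∷_)
open import Data.List.Relation.Unary.Any using (here; there)
open import Data.List.Relation.Unary.Unique.Propositional using (Unique)
open import Data.List.Relation.Unary.Unique.Propositional.Properties using (allFin⁺)
open import Data.Nat using (ℕ; zero; suc; _+_; _*_; _∸_; _^_; _≤_; _<_; _<ᵇ_; z≤n; s≤s;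
  _<?_; _≤?_; _≟_; NonZero; >-nonZero⁻¹)
open import Data.Nat.Combinatorics using (_C_; nC1≡n; nCk+nC[k+1]≡[n+1]C[k+1])
open import Data.Nat.DivMod using (_/_; _%_; m≡m%n+[m/n]*n; m%n<n; /-monoˡ-≤)
open import Data.Nat.ListAction using (sum)
open import Data.Nat.Properties hiding (_≟_; _≤?_; _<?_)
open import Algebra.Properties.Semiring.Sum +-*-semiring
  using (sum-syntax; sum-cong-≗; sum-replicate-zero; ∑-distrib-+; ∑-comm; *-distribˡ-sum; *-distribʳ-sum)
open import Data.Nat.Tactic.RingSolver using (solve-∀)
open import Data.Product using (∃; _×_; _,_; proj₁; proj₂)
open import Data.Sum using (_⊎_; inj₁; inj₂)
open import Function using (_∘_; id)
open import Function.Definitions using (Injective)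
open import Relation.Binary using (tri<; tri≈; tri>)
open import Relation.Binary.PropositionalEquality
open import Relation.Nullary using (¬_; does; yes; no; contradiction)
open import Relation.Nullary.Decidable using (dec-true; dec-false)

-- Counting pairs by double sums

-- The summation inside countPairs is a local definition; abstracting over its
-- arguments lets unification supply a name for it.
mutual
  sumOver : ∀ m (p : Fin m → Fin m → Bool) k → (Fin k → ℕ) → ℕ
  sumOver = _

  countPairs-suc : ∀ k (p : Fin (suc k) → Fin (suc k) → Bool) →
    countPairs p ≡ count (λ j → (0 <ᵇ toℕ j) ∧ p F.zero j)
      + sumOver (suc k) p k (λ i → count (λ j → (toℕ (F.suc i) <ᵇ toℕ j) ∧ p (F.suc i) j))
  countPairs-suc k p
    with count (λ j → (0 <ᵇ toℕ j) ∧ p F.zero j)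
       | (λ (i : Fin k) → count (λ j → (toℕ (F.suc i) <ᵇ toℕ j) ∧ p (F.suc i) j))
  ... | c | f with suc k | p
  ... | M | q = refl

sumOver≡∑ : ∀ m (p : Fin m → Fin m → Bool) {k} (f : Fin k → ℕ) → sumOver m p k f ≡ ∑[ i < k ] f i
sumOver≡∑ m p {zero}  f = refl
sumOver≡∑ m p {suc k} f = cong (f F.zero +_) (sumOver≡∑ m p (λ i → f (F.suc i)))

bit : Bool → ℕ
bit b = if b then 1 else 0

bit≤1 : ∀ b → bit b ≤ 1
bit≤1 true  = s≤s z≤n
bit≤1 false = z≤n

count≡∑ : ∀ {m} (p : Fin m → Bool) → count p ≡ ∑[ i < m ] bit (p i)
count≡∑ {zero}  p = refl
count≡∑ {suc m} p = cong (bit (p F.zero) +_) (count≡∑ (λ i → p (F.suc i)))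

∑∑ : ∀ {m} → (Fin m → Fin m → ℕ) → ℕ
∑∑ {m} f = ∑[ i < m ] ∑[ j < m ] f i j

∑∑-cong : ∀ {m} {f g : Fin m → Fin m → ℕ} → (∀ i j → f i j ≡ g i j) → ∑∑ f ≡ ∑∑ g
∑∑-cong {m} eq = sum-cong-≗ {m} (λ i → sum-cong-≗ {m} (eq i))

∑∑-distrib-+ : ∀ {m} (f g : Fin m → Fin m → ℕ) → ∑∑ (λ i j → f i j + g i j) ≡ ∑∑ f + ∑∑ g
∑∑-distrib-+ {m} f g = trans (sum-cong-≗ {m} (λ i → ∑-distrib-+ (f i) (g i))) (∑-distrib-+ {m} _ _)

∑-mono : ∀ {m} {f g : Fin m → ℕ} → (∀ i → f i ≤ g i) → ∑[ i < m ] f i ≤ ∑[ i < m ] g i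
∑-mono {zero}  le = z≤n
∑-mono {suc m} le = +-mono-≤ (le F.zero) (∑-mono {m} (λ i → le (F.suc i)))

∑-const : ∀ m c → ∑[ i < m ] c ≡ m * c
∑-const zero    c = refl
∑-const (suc m) c = cong (c +_) (∑-const m c)

δ : ∀ {m} → Fin m → Fin m → ℕ
δ i j = bit (does (i F.≟ j))

∑-δ : ∀ {m} i (f : Fin m → ℕ) → ∑[ j < m ] (f j * δ i j) ≡ f i
∑-δ {suc m} F.zero f = begin
  f F.zero * 1 + ∑[ j < m ] (f (F.suc j) * 0)
    ≡⟨ cong₂ _+_ (*-identityʳ _) (trans (sum-cong-≗ {m} (λ j → *-zeroʳ (f (F.suc j)))) (sum-replicate-zero m)) ⟩
  f F.zero + 0  ≡⟨ +-identityʳ _ ⟩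
  f F.zero      ∎
  where open ≡-Reasoning
∑-δ {suc m} (F.suc i) f =
  trans (cong (_+ ∑[ j < m ] (f (F.suc j) * δ i j)) (*-zeroʳ (f F.zero))) (∑-δ i (λ j → f (F.suc j)))

countPairs≡∑∑ : ∀ {m} (p : Fin m → Fin m → Bool) →
  countPairs p ≡ ∑∑ (λ i j → bit ((toℕ i <ᵇ toℕ j) ∧ p i j))
countPairs≡∑∑ {m} p =
  trans (sumOver≡∑ m p {m} (λ i → count (λ j → (toℕ i <ᵇ toℕ j) ∧ p i j)))
        (sum-cong-≗ {m} (λ i → count≡∑ (λ j → (toℕ i <ᵇ toℕ j) ∧ p i j)))

-- Every unordered pair occurs as two ordered ones, so doubling removes the order on the indices.
-- The sum runs over the diagonal and `countPairs` does not, hence a separate `q` that agrees with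
-- `p` off the diagonal and vanishes on it.
countPairs-double : ∀ {m} (p q : Fin m → Fin m → Bool) → (∀ i j → p i j ≡ p j i) →
  (∀ i → q i i ≡ false) → (∀ i j → i ≢ j → q i j ≡ p i j) →
  countPairs p + countPairs p ≡ ∑∑ (λ i j → bit (q i j))
countPairs-double {m} p q p-sym q-irrefl q≡p = begin
  countPairs p + countPairs p
    ≡⟨ cong₂ _+_ (countPairs≡∑∑ p) (trans (countPairs≡∑∑ p) (∑-comm {m} {m} L)) ⟩
  ∑∑ L + ∑∑ (λ i j → L j i)
    ≡⟨ ∑∑-distrib-+ L _ ⟨
  ∑∑ (λ i j → L i j + L j i)
    ≡⟨ ∑∑-cong L+Lᵀ ⟩
  ∑∑ (λ i j → bit (q i j)) ∎
  where
  open ≡-Reasoning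
  L : Fin m → Fin m → ℕ
  L i j = bit ((toℕ i <ᵇ toℕ j) ∧ p i j)
  L-< : ∀ {i j} → toℕ i < toℕ j → L i j ≡ bit (p i j)
  L-< {i} {j} i<j = cong (λ b → bit (b ∧ p i j)) (dec-true (toℕ i <? toℕ j) i<j)
  L-≮ : ∀ {i j} → ¬ (toℕ i < toℕ j) → L i j ≡ 0
  L-≮ {i} {j} i≮j = cong (λ b → bit (b ∧ p i j)) (dec-false (toℕ i <? toℕ j) i≮j)
  L+Lᵀ : ∀ i j → L i j + L j i ≡ bit (q i j)
  L+Lᵀ i j with <-cmp (toℕ i) (toℕ j)
  ... | tri< i<j i≢j j≮i = begin
    L i j + L j i      ≡⟨ cong₂ _+_ (L-< i<j) (L-≮ j≮i) ⟩
    bit (p i j) + 0    ≡⟨ +-identityʳ _ ⟩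
    bit (p i j)        ≡⟨ cong bit (q≡p i j (λ eq → i≢j (cong toℕ eq))) ⟨
    bit (q i j)        ∎
  ... | tri> i≮j i≢j j<i = begin
    L i j + L j i      ≡⟨ cong₂ _+_ (L-≮ i≮j) (L-< j<i) ⟩
    bit (p j i)        ≡⟨ cong bit (p-sym j i) ⟩
    bit (p i j)        ≡⟨ cong bit (q≡p i j (λ eq → i≢j (cong toℕ eq))) ⟨
    bit (q i j)        ∎
  ... | tri≈ i≮j i≡j j≮i with refl ← F.toℕ-injective i≡j = begin
    L i i + L i i      ≡⟨ cong₂ _+_ (L-≮ i≮j) (L-≮ j≮i) ⟩
    0                  ≡⟨ cong bit (q-irrefl i) ⟨
    bit (q i i)        ∎

-- Half of the edges of a cubic graph

-- Both sums run over ordered pairs and count each edge twice, so the slack 2 is a difference of one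
-- edge. With `_xor_` the selected edges are those crossing `S`, with `_∨_` those meeting `S`.
Half : (G : Graph) → (Bool → Bool → Bool) → (Fin (order G) → Bool) → Set
Half G op S = inside ≤ 2 + outside × outside ≤ 2 + inside
  where
  inside  = ∑∑ (λ u v → bit (adj G u v ∧ op (S u) (S v)))
  outside = ∑∑ (λ u v → bit (adj G u v ∧ not (op (S u) (S v))))

even-or-odd : ∀ n → ∃ λ p → n ≡ p + p ⊎ n ≡ suc (p + p)
even-or-odd zero = 0 , inj₁ refl
even-or-odd (suc n) with even-or-odd n
... | p , inj₁ eq = p , inj₂ (cong suc eq)
... | p , inj₂ eq = suc p , inj₁ (cong suc (trans eq (sym (+-suc p p))))

count-witness : ∀ {m} (p : Fin m → Bool) → 0 < count p → ∃ λ i → p i ≡ true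
count-witness {suc m} p pos with p F.zero in eq
... | true  = F.zero , eq
... | false with i , pi ← count-witness (λ j → p (F.suc j)) pos = F.suc i , pi

module _ (G : Graph) (cubic : Cubic G) where

  private
    N = order G

  A : Fin N → Fin N → ℕ
  A u v = bit (adj G u v)

  neighbours : Fin N → (Fin N → ℕ) → ℕ
  neighbours u f = ∑[ v < N ] (A u v * f v)

  -- `inner S` is twice the number of edges with both ends in `S`.
  size inner : (Fin N → Bool) → ℕ
  size S  = ∑[ u < N ] bit (S u)
  inner S = ∑[ u < N ] (bit (S u) * neighbours u (λ v → bit (S v)))

  A-sym : ∀ u v → A u v ≡ A v u
  A-sym u v = cong bit (Graph.sym G u v)

  ∑A≡3 : ∀ u → ∑[ v < N ] A u v ≡ 3
  ∑A≡3 u = trans (sym (count≡∑ (adj G u))) (cubic u)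

  ∑∑A≡N*3 : ∑∑ A ≡ N * 3
  ∑∑A≡N*3 = trans (sum-cong-≗ {N} ∑A≡3) (∑-const N 3)

  -- After exchanging the sums, each value `f v` is counted once for each of the three neighbours of
  -- `v`.
  ∑-neighbours : ∀ f → ∑[ u < N ] neighbours u f ≡ 3 * ∑[ v < N ] f v
  ∑-neighbours f = begin
    ∑[ u < N ] ∑[ v < N ] (A u v * f v)  ≡⟨ ∑-comm {N} {N} (λ u v → A u v * f v) ⟩
    ∑[ v < N ] ∑[ u < N ] (A u v * f v)  ≡⟨ sum-cong-≗ {N} (λ v → *-distribʳ-sum (f v) (λ u → A u v)) ⟨
    ∑[ v < N ] (∑[ u < N ] A u v * f v)
      ≡⟨ sum-cong-≗ {N} (λ v → cong (_* f v) (trans (sum-cong-≗ {N} (λ u → A-sym u v)) (∑A≡3 v))) ⟩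
    ∑[ v < N ] (3 * f v)                 ≡⟨ *-distribˡ-sum 3 f ⟨
    3 * ∑[ v < N ] f v                   ∎
    where open ≡-Reasoning

  -- Summing the degrees in `S` over both coordinates of an ordered pair gives `6 * size S`. A pair
  -- inside `S` is counted there twice, so `c` is 1 if `op` selects such pairs and 2 if it does not.
  edges-by-endpoints : ∀ (op : Bool → Bool → Bool) c →
    (∀ a s t → bit (a ∧ op s t) + c * (bit s * (bit a * bit t)) ≡ bit s * bit a + bit a * bit t) →
    ∀ S → ∑∑ (λ u v → bit (adj G u v ∧ op (S u) (S v))) + c * inner S ≡ 6 * size S
  edges-by-endpoints op c pointwise S = begin
    ∑∑ E + c * inner S
      ≡⟨ cong (λ x → ∑∑ E + c * x) (sum-cong-≗ {N} (λ u → *-distribˡ-sum (s u) (λ v → A u v * s v))) ⟩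
    ∑∑ E + c * ∑∑ I
      ≡⟨ cong (∑∑ E +_) (*-distribˡ-sum {N} c _) ⟩
    ∑∑ E + ∑[ u < N ] (c * ∑[ v < N ] I u v)
      ≡⟨ cong (∑∑ E +_) (sum-cong-≗ {N} (λ u → *-distribˡ-sum c (I u))) ⟩
    ∑∑ E + ∑∑ (λ u v → c * I u v)
      ≡⟨ ∑∑-distrib-+ E _ ⟨
    ∑∑ (λ u v → E u v + c * I u v)
      ≡⟨ ∑∑-cong (λ u v → pointwise (adj G u v) (S u) (S v)) ⟩
    ∑∑ (λ u v → s u * A u v + A u v * s v)
      ≡⟨ ∑∑-distrib-+ (λ u v → s u * A u v) _ ⟩
    ∑∑ (λ u v → s u * A u v) + ∑[ u < N ] neighbours u s
      ≡⟨ cong₂ _+_ (sum-cong-≗ {N} (λ u → sym (*-distribˡ-sum (s u) (A u)))) (∑-neighbours s) ⟩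
    ∑[ u < N ] (s u * ∑[ v < N ] A u v) + 3 * size S
      ≡⟨ cong (_+ 3 * size S) (sum-cong-≗ {N} (λ u → cong (s u *_) (∑A≡3 u))) ⟩
    ∑[ u < N ] (s u * 3) + 3 * size S
      ≡⟨ cong (_+ 3 * size S) (sym (*-distribʳ-sum 3 s)) ⟩
    size S * 3 + 3 * size S
      ≡⟨ solve-6 (size S) ⟩
    6 * size S ∎
    where
    open ≡-Reasoning
    s : Fin N → ℕ
    s u = bit (S u)
    E I : Fin N → Fin N → ℕ
    E u v = bit (adj G u v ∧ op (S u) (S v))
    I u v = s u * (A u v * s v)
    solve-6 : ∀ x → x * 3 + 3 * x ≡ 6 * x
    solve-6 = solve-∀

  edges-complement : ∀ (op : Bool → Bool → Bool) (S : Fin N → Bool) →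
    ∑∑ (λ u v → bit (adj G u v ∧ op (S u) (S v)))
      + ∑∑ (λ u v → bit (adj G u v ∧ not (op (S u) (S v)))) ≡ N * 3
  edges-complement op S = begin
    ∑∑ (λ u v → bit (adj G u v ∧ op (S u) (S v))) + _  ≡⟨ ∑∑-distrib-+ {N} _ _ ⟨
    _  ≡⟨ ∑∑-cong (λ u v → split (adj G u v) (op (S u) (S v))) ⟩
    ∑∑ A  ≡⟨ ∑∑A≡N*3 ⟩
    N * 3 ∎
    where
    open ≡-Reasoning
    split : ∀ a b → bit (a ∧ b) + bit (a ∧ not b) ≡ bit a
    split true  true  = refl
    split true  false = refl
    split false _     = refl

  touched-edges : ∀ S → ∑∑ (λ u v → bit (adj G u v ∧ (S u ∨ S v))) + 1 * inner S ≡ 6 * size S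
  touched-edges = edges-by-endpoints _∨_ 1 λ where
    true  true  true  → refl
    true  true  false → refl
    true  false true  → refl
    true  false false → refl
    false true  _     → refl
    false false _     → refl

  cut-edges : ∀ S → ∑∑ (λ u v → bit (adj G u v ∧ (S u xor S v))) + 2 * inner S ≡ 6 * size S
  cut-edges = edges-by-endpoints _xor_ 2 λ where
    true  true  true  → refl
    true  true  false → refl
    true  false true  → refl
    true  false false → refl
    false true  _     → refl
    false false _     → refl

  neighbours-+ : ∀ u f g → neighbours u (λ v → f v + g v) ≡ neighbours u f + neighbours u g
  neighbours-+ u f g =
    trans (sum-cong-≗ {N} (λ v → *-distribˡ-+ (A u v) (f v) (g v))) (∑-distrib-+ {N} _ _)

  insert : (Fin N → Bool) → Fin N → Fin N → Bool
  insert S z u = S u ∨ does (z F.≟ u)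

  bit-insert : ∀ {S z} → S z ≡ false → ∀ u → bit (insert S z u) ≡ bit (S u) + δ z u
  bit-insert {S} {z} z∉S u with z F.≟ u
  ... | yes refl rewrite z∉S = refl
  ... | no _ with S u
  ...   | true  = refl
  ...   | false = refl

  size-insert : ∀ {S z} → S z ≡ false → size (insert S z) ≡ suc (size S)
  size-insert {S} {z} z∉S = begin
    size (insert S z)                     ≡⟨ sum-cong-≗ {N} (bit-insert {S} z∉S) ⟩
    ∑[ u < N ] (bit (S u) + δ z u)        ≡⟨ ∑-distrib-+ {N} _ _ ⟩
    size S + ∑[ u < N ] δ z u             ≡⟨ cong (size S +_) (sum-cong-≗ {N} (λ u → *-identityˡ (δ z u))) ⟨
    size S + ∑[ u < N ] (1 * δ z u)       ≡⟨ cong (size S +_) (∑-δ z (λ _ → 1)) ⟩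
    size S + 1                            ≡⟨ +-comm (size S) 1 ⟩
    suc (size S)                          ∎
    where open ≡-Reasoning

  -- Each neighbour of `z` in `S` gives a new inner edge, counted in both orders, and `z` is not
  -- adjacent to itself.
  inner-insert : ∀ {S z} → S z ≡ false →
    inner (insert S z) ≡ inner S + 2 * neighbours z (λ v → bit (S v))
  inner-insert {S} {z} z∉S = begin
    inner (insert S z)
      ≡⟨ sum-cong-≗ {N} (λ u → cong₂ _*_ (bit-insert {S} z∉S u) (nb u)) ⟩
    ∑[ u < N ] ((s u + δ z u) * (neighbours u s + A u z))
      ≡⟨ sum-cong-≗ {N} (λ u → expand (s u) (δ z u) (neighbours u s) (A u z)) ⟩
    ∑[ u < N ] ((s u * neighbours u s + A u z * s u) + (neighbours u s + A u z) * δ z u)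
      ≡⟨ ∑-distrib-+ {N} _ _ ⟩
    ∑[ u < N ] (s u * neighbours u s + A u z * s u) + ∑[ u < N ] ((neighbours u s + A u z) * δ z u)
      ≡⟨ cong₂ _+_ (∑-distrib-+ {N} _ _) (∑-δ z (λ u → neighbours u s + A u z)) ⟩
    (inner S + ∑[ u < N ] (A u z * s u)) + (neighbours z s + A z z)
      ≡⟨ cong₂ (λ x y → (inner S + x) + (neighbours z s + y))
               (sum-cong-≗ {N} (λ u → cong (_* s u) (A-sym u z))) (cong bit (irrefl G z)) ⟩
    (inner S + neighbours z s) + (neighbours z s + 0)
      ≡⟨ +-assoc (inner S) _ _ ⟩
    inner S + 2 * neighbours z s ∎
    where
    open ≡-Reasoning
    s : Fin N → ℕ
    s u = bit (S u)
    nb : ∀ u → neighbours u (λ v → bit (insert S z v)) ≡ neighbours u s + A u z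
    nb u = begin
      neighbours u (λ v → bit (insert S z v))  ≡⟨ sum-cong-≗ {N} (λ v → cong (A u v *_) (bit-insert {S} z∉S v)) ⟩
      neighbours u (λ v → s v + δ z v)         ≡⟨ neighbours-+ u s (δ z) ⟩
      neighbours u s + neighbours u (δ z)      ≡⟨ cong (neighbours u s +_) (∑-δ z (A u)) ⟩
      neighbours u s + A u z                   ∎
    expand : ∀ s d n a → (s + d) * (n + a) ≡ (s * n + a * s) + (n + a) * d
    expand = solve-∀

  -- A vertex outside S with no neighbour in S has weight 0; the total weight is 4 |S|.
  independent-vertex : ∀ S → 4 * size S < N →
    ∃ λ z → S z ≡ false × neighbours z (λ v → bit (S v)) ≡ 0
  independent-vertex S 4|S|<N with F.any? (λ z → weight z ≟ 0)
    where
    weight : Fin N → ℕ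
    weight z = bit (S z) + neighbours z (λ v → bit (S v))
  ... | yes (z , eq) = z , bit≡0 (m+n≡0⇒m≡0 _ eq) , m+n≡0⇒n≡0 (bit (S z)) eq
    where
    bit≡0 : ∀ {b} → bit b ≡ 0 → b ≡ false
    bit≡0 {false} _ = refl
  ... | no  none = contradiction N≤4|S| (<⇒≱ 4|S|<N)
    where
    open ≤-Reasoning
    N≤4|S| : N ≤ 4 * size S
    N≤4|S| = begin
      N                       ≡⟨ *-identityʳ N ⟨
      N * 1                   ≡⟨ ∑-const N 1 ⟨
      ∑[ z < N ] 1            ≤⟨ ∑-mono {N} (λ z → n≢0⇒n>0 (λ eq → none (z , eq))) ⟩
      ∑[ z < N ] (bit (S z) + neighbours z (λ v → bit (S v))) ≡⟨ ∑-distrib-+ {N} _ _ ⟩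
      size S + ∑[ z < N ] neighbours z (λ v → bit (S v))      ≡⟨ cong (size S +_) (∑-neighbours _) ⟩
      4 * size S              ∎

  -- Greedy insertion of vertices with no neighbour in the set so far, which creates no inner edges.
  -- The bound says that the set before the last insertion has fewer than `N / 4` vertices, as
  -- `independent-vertex` requires.
  extend : ∀ j S → 4 * (j + size S) < 4 + N →
    ∃ λ S′ → size S′ ≡ j + size S × inner S′ ≡ inner S
  extend zero    S bound = S , refl , refl
  extend (suc j) S bound
    with S′ , size≡ , inner≡ ← extend j S (≤-trans (*-monoʳ-< 4 (n<1+n (j + size S))) (<⇒≤ bound))
    with z , z∉S′ , nb≡0 ← independent-vertex S′
           (subst (λ k → 4 * k < N) (sym size≡)
             (+-cancelˡ-< 4 _ _ (subst (_< 4 + N) (*-suc 4 (j + size S)) bound)))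
    = insert S′ z , trans (size-insert {S′} z∉S′) (cong suc size≡)
    , trans (inner-insert {S′} z∉S′) (trans (cong (λ x → inner S′ + 2 * x) nb≡0) (trans (+-identityʳ _) inner≡))

  -- Starting set for orders that are 2 modulo 4: a vertex and one of its neighbours. Their single
  -- edge, taken in both orders, makes `inner` equal to 2.
  edge-set : Fin N → ∃ λ S → size S ≡ 2 × inner S ≡ 2
  edge-set x = insert ｛x｝ v , trans (size-insert {｛x｝} v∉) (cong suc |x|≡1) , inner≡2
    where
    ∅ ｛x｝ : Fin N → Bool
    ∅ _ = false
    ｛x｝ = insert ∅ x
    nb-∅ : ∀ u → neighbours u (λ _ → 0) ≡ 0
    nb-∅ u = trans (sum-cong-≗ {N} (λ w → *-zeroʳ (A u w))) (sum-replicate-zero N)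
    |x|≡1 : size ｛x｝ ≡ 1
    |x|≡1 = trans (size-insert {∅} {x} refl) (cong suc (sum-replicate-zero N))
    inner-x : inner ｛x｝ ≡ 0
    inner-x = trans (inner-insert {∅} {x} refl) (cong₂ (λ a b → a + 2 * b) (sum-replicate-zero N) (nb-∅ x))
    neighbour : ∃ λ w → adj G x w ≡ true
    neighbour = count-witness (adj G x) (subst (0 <_) (sym (cubic x)) (s≤s z≤n))
    v : Fin N
    v = proj₁ neighbour
    v∉ : ｛x｝ v ≡ false
    v∉ = dec-false (x F.≟ v) λ x≡v → contradiction
      (trans (sym (proj₂ neighbour)) (trans (cong (adj G x) (sym x≡v)) (irrefl G x))) λ ()
    inner≡2 : inner (insert ｛x｝ v) ≡ 2
    inner≡2 = trans (inner-insert {｛x｝} v∉)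
      (cong₂ (λ a b → a + 2 * b) inner-x
        (trans (∑-δ x (A v)) (cong bit (trans (Graph.sym G v x) (proj₂ neighbour)))))

  -- Handshake argument: `N * 3` is twice the number of edges, so `N` cannot be odd.
  order-even : ∃ λ m → N ≡ m + m
  order-even with even-or-odd N
  ... | m , inj₁ eq = m , eq
  ... | m , inj₂ eq = contradiction parity (even≢odd (countPairs (adj G)) (3 * m + 1))
    where
    arith : ∀ m → suc (m + m) * 3 ≡ suc (2 * (3 * m + 1))
    arith = solve-∀
    double : ∀ c → 2 * c ≡ c + c
    double = solve-∀
    parity : 2 * countPairs (adj G) ≡ suc (2 * (3 * m + 1))
    parity = begin
      2 * countPairs (adj G)                    ≡⟨ double (countPairs (adj G)) ⟩
      countPairs (adj G) + countPairs (adj G)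
        ≡⟨ countPairs-double (adj G) (adj G) (Graph.sym G) (irrefl G) (λ _ _ _ → refl) ⟩
      ∑∑ A                                      ≡⟨ ∑∑A≡N*3 ⟩
      N * 3                                     ≡⟨ cong (_* 3) eq ⟩
      suc (m + m) * 3                           ≡⟨ arith m ⟩
      suc (2 * (3 * m + 1))                     ∎
      where open ≡-Reasoning

  3≤order : 1 ≤ N → 3 ≤ N
  3≤order 1≤N = begin
    3                     ≡⟨ ∑A≡3 x ⟨
    ∑[ v < N ] A x v      ≤⟨ ∑-mono {N} (λ v → bit≤1 (adj G x v)) ⟩
    ∑[ v < N ] 1          ≡⟨ ∑-const N 1 ⟩
    N * 1                 ≡⟨ *-identityʳ N ⟩
    N                     ∎
    where
    open ≤-Reasoning
    x : Fin N
    x = F.fromℕ< 1≤N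

  half-intro : ∀ (op : Bool → Bool → Bool) (S : Fin N → Bool) x y →
    ∑∑ (λ u v → bit (adj G u v ∧ op (S u) (S v))) ≡ x →
    N * 3 ≡ x + y → x ≤ 2 + y → y ≤ 2 + x → Half G op S
  half-intro op S x y in≡x total x≤ y≤
    rewrite in≡x
          | +-cancelˡ-≡ x _ y (trans (cong (_+ ∑∑ (λ u v → bit (adj G u v ∧ not (op (S u) (S v))))) (sym in≡x))
                                     (trans (edges-complement op S) total)) = x≤ , y≤

  -- Here `c` counts the cut edges and `t` the touched ones, in ordered pairs. As they add up to
  -- `N * 3`, there are `t` uncut and `c` untouched ones, so the same two inequalities settle both
  -- patterns with one set.
  half-cut-and-touched : ∀ {k i} c t → c + 2 * i ≡ 6 * k → t + 1 * i ≡ 6 * k →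
    N * 3 ≡ c + t → c ≤ 2 + t → t ≤ 2 + c → (∃ λ S → size S ≡ k × inner S ≡ i) →
    ∃ λ S → Half G _xor_ S × Half G _∨_ S
  half-cut-and-touched c t cut≡ touched≡ total c≤ t≤ (S , refl , refl) = S
    , half-intro _xor_ S c t (+-cancelʳ-≡ (2 * inner S) _ _ (trans (cut-edges S) (sym cut≡))) total c≤ t≤
    , half-intro _∨_ S t c (+-cancelʳ-≡ (1 * inner S) _ _ (trans (touched-edges S) (sym touched≡)))
        (trans total (+-comm c t)) t≤ c≤

  extend-by : ∀ {k i} j → (∃ λ S → size S ≡ k × inner S ≡ i) → 4 * (j + k) < 4 + N →
    ∃ λ S → size S ≡ j + k × inner S ≡ i
  extend-by j (S , refl , refl) bound = extend j S bound

  half-set-4p : ∀ p → N ≡ 4 * p → ∃ λ S → Half G _xor_ S × Half G _∨_ S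
  -- An independent set of `p` vertices touches and cuts `6 * p` of the `12 * p` ordered pairs.
  half-set-4p p N≡ = half-cut-and-touched (6 * p) (6 * p) (arith₁ p) (arith₂ p)
    (trans (cong (_* 3) N≡) (arith₃ p)) (m≤n+m _ 2) (m≤n+m _ 2)
    (extend-by p ((λ _ → false) , sum-replicate-zero N , sum-replicate-zero N) bound)
    where
    arith₁ : ∀ p → 6 * p + 0 ≡ 6 * (p + 0)
    arith₁ = solve-∀
    arith₂ : ∀ p → 6 * p + 1 * 0 ≡ 6 * (p + 0)
    arith₂ = solve-∀
    arith₃ : ∀ p → 4 * p * 3 ≡ 6 * p + 6 * p
    arith₃ = solve-∀
    bound : 4 * (p + 0) < 4 + N
    bound = begin-strict
      4 * (p + 0)  ≡⟨ cong (4 *_) (+-identityʳ p) ⟩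
      4 * p        ≡⟨ N≡ ⟨
      N            <⟨ m≤n+m (suc N) 3 ⟩
      4 + N        ∎
      where open ≤-Reasoning

  half-set-4p+6 : ∀ p → N ≡ 4 * p + 6 → Fin N → ∃ λ S → Half G _xor_ S × Half G _∨_ S
  -- The set has `p + 2` vertices and one inner edge, so `6 * (p + 2)` is reduced by 4 for the cut
  -- and by 2 for the touched pairs. The counts differ by 2, that is, by one edge.
  half-set-4p+6 p N≡ x = half-cut-and-touched (6 * p + 8) (6 * p + 10) (arith₁ p) (arith₂ p)
    (trans (cong (_* 3) N≡) (arith₃ p))
    (≤-trans (+-monoʳ-≤ (6 * p) (m≤n+m 8 2)) (m≤n+m _ 2)) (≤-reflexive (arith₄ p))
    (extend-by p (edge-set x) bound)
    where
    arith₁ : ∀ p → 6 * p + 8 + 2 * 2 ≡ 6 * (p + 2)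
    arith₁ = solve-∀
    arith₂ : ∀ p → 6 * p + 10 + 1 * 2 ≡ 6 * (p + 2)
    arith₂ = solve-∀
    arith₃ : ∀ p → (4 * p + 6) * 3 ≡ (6 * p + 8) + (6 * p + 10)
    arith₃ = solve-∀
    arith₄ : ∀ p → 6 * p + 10 ≡ 2 + (6 * p + 8)
    arith₄ = solve-∀
    arith₅ : ∀ p → 2 + 4 * (p + 2) ≡ 4 + (4 * p + 6)
    arith₅ = solve-∀
    bound : 4 * (p + 2) < 4 + N
    bound = begin-strict
      4 * (p + 2)        <⟨ m≤n+m (suc (4 * (p + 2))) 1 ⟩
      2 + 4 * (p + 2)    ≡⟨ arith₅ p ⟩
      4 + (4 * p + 6)    ≡⟨ cong (4 +_) N≡ ⟨
      4 + N              ∎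
      where open ≤-Reasoning

  half-set : 1 ≤ N → ∃ λ S → Half G _xor_ S × Half G _∨_ S
  half-set 1≤N with order-even
  ... | m , N≡m+m with even-or-odd m
  ...   | p     , inj₁ refl = half-set-4p p (trans N≡m+m (arith p))
    where
    arith : ∀ p → p + p + (p + p) ≡ 4 * p
    arith = solve-∀
  -- Order 2 would leave too few vertices for degree 3; the remaining orders of this class are
  -- written as `4 * p + 6`.
  ...   | zero  , inj₂ refl = contradiction (3≤order 1≤N) (<⇒≱ (s≤s (≤-reflexive N≡m+m)))
  ...   | suc p , inj₂ refl = half-set-4p+6 p (trans N≡m+m (arith p)) (F.fromℕ< 1≤N)
    where
    arith : ∀ p → suc (suc p + suc p) + suc (suc p + suc p) ≡ 4 * p + 6
    arith = solve-∀

-- Homogeneous sublists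

AllPairs-resp-⊆ : ∀ {A : Set} {_∼_ : A → A → Set} {xs ys : List A} →
  xs ⊆ ys → AllPairs _∼_ ys → AllPairs _∼_ xs
AllPairs-resp-⊆ []         []       = []
AllPairs-resp-⊆ (_ ∷ʳ τ)   (_ ∷ ps) = AllPairs-resp-⊆ τ ps
AllPairs-resp-⊆ (refl ∷ τ) (p ∷ ps) = All-resp-⊆ τ p ∷ AllPairs-resp-⊆ τ ps

AllPairs-lookup : ∀ {A : Set} {_∼_ : A → A → Set} → (∀ {x y} → x ∼ y → y ∼ x) →
  ∀ {xs} → AllPairs _∼_ xs → ∀ i j → i ≢ j → lookup xs i ∼ lookup xs j
AllPairs-lookup ∼-sym (p ∷ ps) F.zero    F.zero    i≢j = contradiction refl i≢j
AllPairs-lookup ∼-sym (p ∷ ps) F.zero    (F.suc j) i≢j = All.lookup p (∈-lookup j)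
AllPairs-lookup ∼-sym (p ∷ ps) (F.suc i) F.zero    i≢j = ∼-sym (All.lookup p (∈-lookup i))
AllPairs-lookup ∼-sym (p ∷ ps) (F.suc i) (F.suc j) i≢j =
  AllPairs-lookup ∼-sym ps i j (λ i≡j → i≢j (cong F.suc i≡j))

-- Pigeonhole: each element scanned lowers one of the two quotas `a` and `b` by one, until a quota
-- reaches zero.
split : ∀ {A : Set} (q : A → Bool) a b xs → a + b ≤ length xs →
  (∃ λ ys → ys ⊆ xs × a ≤ length ys × All (λ x → q x ≡ true) ys) ⊎
  (∃ λ ys → ys ⊆ xs × b ≤ length ys × All (λ x → q x ≡ false) ys)
split q zero    b       xs _ = inj₁ ([] , minimum xs , z≤n , [])
split q (suc a) zero    xs _ = inj₂ ([] , minimum xs , z≤n , [])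
split q (suc a) (suc b) (x ∷ xs) (s≤s le) with q x in qx
... | true with split q a (suc b) xs le
...   | inj₁ (ys , τ , len , all) = inj₁ (x ∷ ys , refl ∷ τ , s≤s len , qx ∷ all)
...   | inj₂ (ys , τ , len , all) = inj₂ (ys , x ∷ʳ τ , len , all)
split q (suc a) (suc b) (x ∷ xs) (s≤s le) | false
  with split q (suc a) b xs (subst (_≤ length xs) (+-suc a b) le)
...   | inj₁ (ys , τ , len , all) = inj₁ (ys , x ∷ʳ τ , len , all)
...   | inj₂ (ys , τ , len , all) = inj₂ (x ∷ ys , refl ∷ τ , s≤s len , qx ∷ all)

-- Every element of `ys` costs a factor 2: the recursive call leaves `t + t` elements, of which
-- `split` keeps `t` that agree on `y`.
homogeneous : ∀ {A : Set} (p : A → A → Bool) ys t xs → 2 ^ length ys * t ≤ length xs →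
  ∃ λ xs′ → xs′ ⊆ xs × t ≤ length xs′ ×
    (∀ {x x′ y} → x ∈ xs′ → x′ ∈ xs′ → y ∈ ys → p x y ≡ p x′ y)
homogeneous p []       t xs le = xs , ⊆-refl , subst (_≤ length xs) (+-identityʳ t) le , λ _ _ ()
homogeneous {A} p (y ∷ ys) t xs le
  with homogeneous p ys (t + t) xs (subst (_≤ length xs) (arith (2 ^ length ys) t) le)
  where
  arith : ∀ a t → 2 * a * t ≡ a * (t + t)
  arith = solve-∀
... | xs₁ , τ₁ , len₁ , hom₁ with split (λ x → p x y) t t xs₁ len₁
...   | inj₁ (xs₂ , τ₂ , len₂ , all) = xs₂ , ⊆-trans τ₂ τ₁ , len₂ , λ where
        x∈ x′∈ (here refl) → trans (All.lookup all x∈) (sym (All.lookup all x′∈))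
        x∈ x′∈ (there y∈)  → hom₁ (⊆-lookup τ₂ x∈) (⊆-lookup τ₂ x′∈) y∈
...   | inj₂ (xs₂ , τ₂ , len₂ , all) = xs₂ , ⊆-trans τ₂ τ₁ , len₂ , λ where
        x∈ x′∈ (here refl) → trans (All.lookup all x∈) (sym (All.lookup all x′∈))
        x∈ x′∈ (there y∈)  → hom₁ (⊆-lookup τ₂ x∈) (⊆-lookup τ₂ x′∈) y∈

-- The Erdős-Szekeres recursion: one vertex, and enough others for `split` to reach one of the two
-- smaller bounds.
ramseyBound : ℕ → ℕ → ℕ
ramseyBound zero    b       = 0
ramseyBound (suc a) zero    = 0
ramseyBound (suc a) (suc b) = suc (ramseyBound a (suc b) + ramseyBound (suc a) b)

-- Counting

sum-map-allFin : ∀ {n} (f : Fin n → ℕ) → sum (map f (allFin n)) ≡ ∑[ i < n ] f i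
sum-map-allFin f = trans (cong sum (map-tabulate id f)) (sum-tabulate f)
  where
  sum-tabulate : ∀ {n} (f : Fin n → ℕ) → sum (tabulate f) ≡ ∑[ i < n ] f i
  sum-tabulate {zero}  f = refl
  sum-tabulate {suc n} f = cong (f F.zero +_) (sum-tabulate (f ∘ F.suc))

-- Elements with value at least `h` contribute at most `M` each, the others at most `h`. A large sum
-- therefore forces many large values.
markov : ∀ {A : Set} (f : A → ℕ) M h → (∀ x → f x ≤ M) → ∀ xs →
  sum (map f xs) ≤ length (filter (λ x → h ≤? f x) xs) * M + length xs * h
markov f M h f≤M []       = z≤n
markov f M h f≤M (x ∷ xs) with h ≤? f x
... | yes h≤f = begin
  f x + sum (map f xs)                             ≤⟨ +-mono-≤ (f≤M x) (markov f M h f≤M xs) ⟩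
  M + (length g * M + length xs * h)               ≡⟨ +-assoc M _ _ ⟨
  suc (length g) * M + length xs * h               ≤⟨ +-monoʳ-≤ (suc (length g) * M) (m≤n+m _ h) ⟩
  suc (length g) * M + (h + length xs * h)
    ≡⟨ cong (λ l → length l * M + (h + length xs * h)) (filter-accept (λ x → h ≤? f x) h≤f) ⟨
  length (filter (λ x → h ≤? f x) (x ∷ xs)) * M + (h + length xs * h) ∎
  where
  open ≤-Reasoning
  g = filter (λ x → h ≤? f x) xs
... | no h≰f = begin
  f x + sum (map f xs)                             ≤⟨ +-mono-≤ (<⇒≤ (≰⇒> h≰f)) (markov f M h f≤M xs) ⟩
  h + (length g * M + length xs * h)               ≡⟨ arith h (length g * M) (length xs * h) ⟩
  length g * M + (h + length xs * h)
    ≡⟨ cong (λ l → length l * M + (h + length xs * h)) (filter-reject (λ x → h ≤? f x) h≰f) ⟨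
  length (filter (λ x → h ≤? f x) (x ∷ xs)) * M + (h + length xs * h) ∎
  where
  open ≤-Reasoning
  g = filter (λ x → h ≤? f x) xs
  arith : ∀ a b c → a + (b + c) ≡ b + (a + c)
  arith = solve-∀

markov-Fin : ∀ {n} (f : Fin n → ℕ) M h → (∀ x → f x ≤ M) →
  ∑[ i < n ] f i ≤ length (filter (λ x → h ≤? f x) (allFin n)) * M + n * h
markov-Fin {n} f M h f≤M =
  subst₂ (λ s l → s ≤ length (filter (λ x → h ≤? f x) (allFin n)) * M + l * h)
    (sum-map-allFin f) (length-tabulate {n = n} id) (markov f M h f≤M (allFin n))

∑-sum-swap : ∀ {n} {A : Set} (f : Fin n → A → ℕ) ys →
  ∑[ i < n ] sum (map (f i) ys) ≡ sum (map (λ y → ∑[ i < n ] f i y) ys)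
∑-sum-swap {n} f []       = sum-replicate-zero n
∑-sum-swap {n} f (y ∷ ys) =
  trans (∑-distrib-+ (λ i → f i y) (λ i → sum (map (f i) ys))) (cong (∑[ i < n ] f i y +_) (∑-sum-swap f ys))

length*≤sum : ∀ {A : Set} (f : A → ℕ) h ys → All (λ y → h ≤ f y) ys → length ys * h ≤ sum (map f ys)
length*≤sum f h []       []       = z≤n
length*≤sum f h (y ∷ ys) (p ∷ ps) = +-mono-≤ p (length*≤sum f h ys ps)

sum-bit≤length : ∀ {A : Set} (q : A → Bool) ys → sum (map (λ y → bit (q y)) ys) ≤ length ys
sum-bit≤length q []       = z≤n
sum-bit≤length q (y ∷ ys) = +-mono-≤ (bit≤1 (q y)) (sum-bit≤length q ys)

length-filter-bit : ∀ {A : Set} (q : A → Bool) ys →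
  length (filter (λ y → q y Bool.≟ true) ys) ≡ sum (map (λ y → bit (q y)) ys)
length-filter-bit q []       = refl
length-filter-bit q (y ∷ ys) with q y
... | true  = cong suc (length-filter-bit q ys)
... | false = length-filter-bit q ys

-- Colourings

opp : Color → Color
opp R = B
opp B = R

is : Color → Color → Bool
is R = isR
is B = isB

is-true : ∀ κ {κ′} → is κ κ′ ≡ true → κ′ ≡ κ
is-true R {R} _ = refl
is-true B {B} _ = refl

is-false : ∀ κ {κ′} → is κ κ′ ≡ false → κ′ ≡ opp κ
is-false R {B} _ = refl
is-false B {R} _ = refl

opp≢ : ∀ κ → opp κ ≢ κ
opp≢ R ()
opp≢ B ()

module _ {n : ℕ} (φ : Coloring n) where

  Coloured : Color → Fin n → Fin n → Set
  Coloured κ x y = x ≢ y × col φ x y ≡ κ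

  Coloured-sym : ∀ {κ x y} → Coloured κ x y → Coloured κ y x
  Coloured-sym {κ} {x} {y} (x≢y , c) = (λ y≡x → x≢y (sym y≡x)) , trans (colSym φ y x) c

  Clique : Color → List (Fin n) → Set
  Clique κ = AllPairs (Coloured κ)

  -- The first vertex `x` has many neighbours in one of the two colours. A clique found among them
  -- is either large enough already or becomes so by adding `x`.
  ramsey : ∀ κ a b xs → Unique xs → ramseyBound a b ≤ length xs →
    (∃ λ ys → ys ⊆ xs × length ys ≡ a × Clique κ ys) ⊎
    (∃ λ ys → ys ⊆ xs × length ys ≡ b × Clique (opp κ) ys)
  ramsey κ zero    b       xs _ _ = inj₁ ([] , minimum xs , refl , [])
  ramsey κ (suc a) zero    xs _ _ = inj₂ ([] , minimum xs , refl , [])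
  ramsey κ (suc a) (suc b) (x ∷ xs) (x∉xs ∷ unique) (s≤s le)
    with split (λ y → is κ (col φ x y)) (ramseyBound a (suc b)) (ramseyBound (suc a) b) xs le
  ... | inj₁ (ys , τ , len , κ-nbrs) with ramsey κ a (suc b) ys (AllPairs-resp-⊆ τ unique) len
  ...   | inj₂ (zs , σ , len′ , clique) = inj₂ (zs , x ∷ʳ ⊆-trans σ τ , len′ , clique)
  ...   | inj₁ (zs , σ , len′ , clique) = inj₁ (x ∷ zs , refl ∷ ⊆-trans σ τ , cong suc len′ ,
            All.zipWith (λ (x≢y , c) → x≢y , is-true κ c)
              (All-resp-⊆ (⊆-trans σ τ) x∉xs , All-resp-⊆ σ κ-nbrs) ∷ clique)
  ramsey κ (suc a) (suc b) (x ∷ xs) (x∉xs ∷ unique) (s≤s le)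
      | inj₂ (ys , τ , len , κ-nbrs) with ramsey κ (suc a) b ys (AllPairs-resp-⊆ τ unique) len
  ...   | inj₁ (zs , σ , len′ , clique) = inj₁ (zs , x ∷ʳ ⊆-trans σ τ , len′ , clique)
  ...   | inj₂ (zs , σ , len′ , clique) = inj₂ (x ∷ zs , refl ∷ ⊆-trans σ τ , cong suc len′ ,
            All.zipWith (λ (x≢y , c) → x≢y , is-false κ c)
              (All-resp-⊆ (⊆-trans σ τ) x∉xs , All-resp-⊆ σ κ-nbrs) ∷ clique)

  -- Bicliques in a dense colour class

  adjacent : Color → Fin n → Fin n → Bool
  -- The colouring takes arbitrary values on the diagonal, so equal vertices are excluded
  -- explicitly.
  adjacent κ x y = not (does (x F.≟ y)) ∧ is κ (col φ x y)

  adjacent⇒Coloured : ∀ κ {x y} → adjacent κ x y ≡ true → Coloured κ x y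
  adjacent⇒Coloured κ {x} {y} adj with x F.≟ y
  ... | no x≢y = x≢y , is-true κ adj

  degreeIn : Color → Fin n → ℕ
  degreeIn κ y = ∑[ x < n ] bit (adjacent κ x y)

  degreeIn≤n : ∀ κ y → degreeIn κ y ≤ n
  degreeIn≤n κ y = begin
    degreeIn κ y   ≤⟨ ∑-mono {n} (λ x → bit≤1 (adjacent κ x y)) ⟩
    ∑[ x < n ] 1   ≡⟨ ∑-const n 1 ⟩
    n * 1          ≡⟨ *-identityʳ n ⟩
    n              ∎
    where open ≤-Reasoning

  -- The two sides are disjoint, because `Coloured` includes distinctness.
  Biclique : Color → ℕ → Set
  Biclique κ T = ∃ λ xs → ∃ λ ys → Unique xs × Unique ys × T ≤ length xs × T ≤ length ys ×
    (∀ {x y} → x ∈ xs → y ∈ ys → Coloured κ x y)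

  -- Kővári–Sós–Turán by pigeonhole: fix s = 4T vertices of degree at least h ≈ n/2 - s.
  -- On average a vertex is adjacent to almost half of them, so at least 2 ^ s * T vertices
  -- are adjacent to T of them, and T of these vertices have the same neighbours among the s.
  module _ (κ : Color) (T h r : ℕ) .{{_ : NonZero T}} where
    private
      s = 4 * T
      M = 2 ^ s * T

    biclique : n ≡ 2 * (s + h) + 2 + r → r ≤ 1 → 3 ≤ n → 2 * M + 4 * T + 2 ≤ h →
      n * n ≤ 2 * ∑[ y < n ] degreeIn κ y + 2 + n → Biclique κ T
    biclique n≡ r≤1 3≤n h-large dense = from-good (homogeneous (adjacent κ) ys₀ T good good-large)
      where
      open ≤-Reasoning
      high = filter (λ y → h ≤? degreeIn κ y) (allFin n)
      -- With fewer than `s` high vertices the degree sum is at most `s * n + n * h`. Density then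
      -- gives `n + n ≤ 2 + n`, against `3 ≤ n`.
      s≤high : s ≤ length high
      s≤high = ≮⇒≥ λ high<s → <⇒≱ 2+n<n+n (+-cancelˡ-≤ (n * (2 * (s + h))) _ _ (begin
        n * (2 * (s + h)) + (n + n)               ≤⟨ m≤m+n _ (n * r) ⟩
        n * (2 * (s + h)) + (n + n) + n * r       ≡⟨ arith₁ n (2 * (s + h)) r ⟩
        n * (2 * (s + h) + 2 + r)                 ≡⟨ cong (n *_) n≡ ⟨
        n * n                                     ≤⟨ dense ⟩
        2 * ∑[ y < n ] degreeIn κ y + 2 + n
          ≤⟨ +-monoˡ-≤ n (+-monoˡ-≤ 2 (*-monoʳ-≤ 2 (≤-trans (markov-Fin (degreeIn κ) n h (degreeIn≤n κ))
               (+-monoˡ-≤ (n * h) (*-monoˡ-≤ n (<⇒≤ high<s)))))) ⟩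
        2 * (s * n + n * h) + 2 + n               ≡⟨ arith₂ n s h ⟩
        n * (2 * (s + h)) + (2 + n)               ∎))
        where
        2+n<n+n : 2 + n < n + n
        2+n<n+n = +-monoˡ-< n 3≤n
        arith₁ : ∀ n a r → n * a + (n + n) + n * r ≡ n * (a + 2 + r)
        arith₁ = solve-∀
        arith₂ : ∀ n s h → 2 * (s * n + n * h) + 2 + n ≡ n * (2 * (s + h)) + (2 + n)
        arith₂ = solve-∀
      ys₀ = take s high
      |ys₀|≡s : length ys₀ ≡ s
      |ys₀|≡s = trans (length-take s high) (m≤n⇒m⊓n≡m s≤high)
      ys₀⊆ : ys₀ ⊆ allFin n
      ys₀⊆ = ⊆-trans (take-⊆ s high) (filter-⊆ (λ y → h ≤? degreeIn κ y) (allFin n))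
      into : Fin n → ℕ
      into x = sum (map (λ y → bit (adjacent κ x y)) ys₀)
      good = filter (λ x → T ≤? into x) (allFin n)
      -- Double counting of the coloured edges between `ys₀` and all vertices: at least `h` for each
      -- element of `ys₀`, and `markov` bounds the sum from the other side.
      count-into : s * h ≤ length good * s + n * T
      count-into = begin
        s * h                                ≡⟨ cong (_* h) |ys₀|≡s ⟨
        length ys₀ * h                       ≤⟨ length*≤sum (degreeIn κ) h ys₀
          (All-resp-⊆ (take-⊆ s high) (all-filter (λ y → h ≤? degreeIn κ y) (allFin n))) ⟩
        sum (map (degreeIn κ) ys₀)           ≡⟨ ∑-sum-swap (λ x y → bit (adjacent κ x y)) ys₀ ⟨
        ∑[ x < n ] into x                    ≤⟨ markov-Fin into s T
          (λ x → ≤-trans (sum-bit≤length (adjacent κ x) ys₀) (≤-reflexive |ys₀|≡s)) ⟩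
        length good * s + n * T              ∎
      -- Otherwise `count-into`, divided by `T`, gives `4 * h ≤ 4 * M + n`. As `n` is at most
      -- `2 * h + 8 * T + 3`, this contradicts `h-large`.
      M≤good : M ≤ length good
      M≤good = ≮⇒≥ λ good<M → <⇒≱ (begin-strict
        4 * M + (2 * (4 * T + h) + 2 + r)      ≤⟨ +-monoʳ-≤ (4 * M) (+-monoʳ-≤ (2 * (s + h) + 2) r≤1) ⟩
        4 * M + (2 * (4 * T + h) + 2 + 1)      <⟨ ≤-reflexive (arith₁ M T h) ⟩
        2 * (2 * M + 4 * T + 2) + 2 * h        ≤⟨ +-monoˡ-≤ (2 * h) (*-monoʳ-≤ 2 h-large) ⟩
        2 * h + 2 * h                          ≡⟨ arith₂ h ⟩
        4 * h                                  ∎)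
        (*-cancelˡ-≤ T (begin
          T * (4 * h)                                  ≡⟨ arith₃ T h ⟩
          s * h                                        ≤⟨ count-into ⟩
          length good * s + n * T                      ≤⟨ +-monoˡ-≤ (n * T) (*-monoˡ-≤ s (<⇒≤ good<M)) ⟩
          M * s + n * T                                ≡⟨ arith₄ M T n ⟩
          T * (4 * M + n)                              ≡⟨ cong (λ n → T * (4 * M + n)) n≡ ⟩
          T * (4 * M + (2 * (4 * T + h) + 2 + r))      ∎))
        where
        arith₁ : ∀ M T h → suc (4 * M + (2 * (4 * T + h) + 2 + 1)) ≡ 2 * (2 * M + 4 * T + 2) + 2 * h
        arith₁ = solve-∀
        arith₂ : ∀ h → 2 * h + 2 * h ≡ 4 * h
        arith₂ = solve-∀
        arith₃ : ∀ T h → T * (4 * h) ≡ 4 * T * h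
        arith₃ = solve-∀
        arith₄ : ∀ M T n → M * (4 * T) + n * T ≡ T * (4 * M + n)
        arith₄ = solve-∀
      good-large : 2 ^ length ys₀ * T ≤ length good
      good-large = subst (λ l → 2 ^ l * T ≤ length good) (sym |ys₀|≡s) M≤good
      from-good : (∃ λ xs → xs ⊆ good × T ≤ length xs ×
        (∀ {x x′ y} → x ∈ xs → x′ ∈ xs → y ∈ ys₀ → adjacent κ x y ≡ adjacent κ x′ y)) → Biclique κ T
      -- Since `T` is nonzero, the list has a first vertex `x₀` that can represent all of `xs`.
      from-good ([] , _ , T≤0 , _) = contradiction T≤0 (<⇒≱ (>-nonZero⁻¹ T))
      from-good (xs@(x₀ ∷ _) , τ , T≤xs , hom) = xs , ys , AllPairs-resp-⊆ xs⊆ (allFin⁺ n)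
        , AllPairs-resp-⊆ (⊆-trans ys⊆ ys₀⊆) (allFin⁺ n) , T≤xs
        , ≤-trans (proj₂ (∈-filter⁻ (λ x → T ≤? into x) {xs = allFin n} (⊆-lookup τ (here refl))))
                  (≤-reflexive (sym (length-filter-bit (adjacent κ x₀) ys₀)))
        , λ x∈ y∈ → adjacent⇒Coloured κ (trans (hom x∈ (here refl) (⊆-lookup ys⊆ y∈))
                      (proj₂ (∈-filter⁻ (λ y → adjacent κ x₀ y Bool.≟ true) {xs = ys₀} y∈)))
        where
        xs⊆ : xs ⊆ allFin n
        xs⊆ = ⊆-trans τ (filter-⊆ (λ x → T ≤? into x) (allFin n))
        -- The second side consists of the neighbours of `x₀` in `ys₀`. There are at least `T`,
        -- because `x₀` is good, and by homogeneity they are adjacent to all of `xs`.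
        ys = filter (λ y → adjacent κ x₀ y Bool.≟ true) ys₀
        ys⊆ : ys ⊆ ys₀
        ys⊆ = filter-⊆ (λ y → adjacent κ x₀ y Bool.≟ true) ys₀

-- Embedding G into a pattern

half-≤ : ∀ a b → a + a ≤ 2 + (b + b) → a ≤ suc b
half-≤ a b le = *-cancelˡ-≤ 2 (subst₂ _≤_ (arith₁ a) (arith₂ b) le)
  where
  arith₁ : ∀ a → a + a ≡ 2 * a
  arith₁ = solve-∀
  arith₂ : ∀ b → 2 + (b + b) ≡ 2 * suc b
  arith₂ = solve-∀

choose : Bool → Color → Color
choose b κ = if b then κ else opp κ

is-choose : ∀ κ b → is κ (choose b κ) ≡ b
is-choose R true  = refl
is-choose R false = refl
is-choose B true  = refl
is-choose B false = refl

is-opp-choose : ∀ κ b → is (opp κ) (choose b κ) ≡ not b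
is-opp-choose R true  = refl
is-opp-choose R false = refl
is-opp-choose B true  = refl
is-opp-choose B false = refl

other : ∀ {m} → 2 ≤ m → (u : Fin m) → ∃ λ v → u ≢ v
other (s≤s (s≤s _)) F.zero    = F.suc F.zero , λ ()
other (s≤s (s≤s _)) (F.suc u) = F.zero , λ ()

-- The length from which `homogeneous` extracts `N` elements that agree on a list of `N + N`.
cliqueBound : ℕ → ℕ
cliqueBound N = 2 ^ (N + N) * N

module _ {n : ℕ} (φ : Coloring n) (G : Graph) where
  private
    N = order G

  -- Edges selected by `op` get colour `κ` and all others the opposite one, so `Half` is exactly the
  -- balance condition, doubled. Injectivity comes from the distinctness in `Coloured`.
  balanced-copy : ∀ κ (op : Bool → Bool → Bool) S (f : Fin N → Fin n) →
    (∀ u v → u ≢ v → Coloured φ (choose (op (S u) (S v)) κ) (f u) (f v)) →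
    Half G op S → HasBalancedCopy φ G
  balanced-copy κ op S f coloured (in≤ , out≤) = f , injective , ordered κ κ-edges≤ opp-edges≤
    where
    injective : Injective _≡_ _≡_ f
    injective {u} {v} fu≡fv with u F.≟ v
    ... | yes u≡v = u≡v
    ... | no  u≢v = contradiction fu≡fv (proj₁ (coloured u v u≢v))
    edges : Color → ℕ
    edges κ′ = countPairs (λ u v → adj G u v ∧ is κ′ (col φ (f u) (f v)))
    double : ∀ κ′ (b : Bool → Bool) → (∀ x → is κ′ (choose x κ) ≡ b x) →
      edges κ′ + edges κ′ ≡ ∑∑ (λ u v → bit (adj G u v ∧ b (op (S u) (S v))))
    double κ′ b is≡b = countPairs-double _ _
      (λ u v → cong₂ (λ x y → x ∧ is κ′ y) (Graph.sym G u v) (colSym φ (f u) (f v)))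
      (λ u → cong (_∧ b (op (S u) (S u))) (irrefl G u))
      (λ u v u≢v → cong (adj G u v ∧_)
        (sym (trans (cong (is κ′) (proj₂ (coloured u v u≢v))) (is≡b (op (S u) (S v))))))
    κ-edges≤ : edges κ ≤ suc (edges (opp κ))
    κ-edges≤ = half-≤ _ _ (subst₂ (λ a b → a ≤ 2 + b)
      (sym (double κ id (is-choose κ))) (sym (double (opp κ) not (is-opp-choose κ))) in≤)
    opp-edges≤ : edges (opp κ) ≤ suc (edges κ)
    opp-edges≤ = half-≤ _ _ (subst₂ (λ a b → a ≤ 2 + b)
      (sym (double (opp κ) not (is-opp-choose κ))) (sym (double κ id (is-choose κ))) out≤)
    ordered : ∀ κ → edges κ ≤ suc (edges (opp κ)) → edges (opp κ) ≤ suc (edges κ) →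
      edges R ≤ suc (edges B) × edges B ≤ suc (edges R)
    ordered R r≤ b≤ = r≤ , b≤
    ordered B b≤ r≤ = r≤ , b≤

  place : (S : Fin N → Bool) (α β : Fin N → Fin n) → Fin N → Fin n
  place S α β u = if S u then α u else β u

  CliqueMap : Color → (Fin N → Fin n) → Set
  CliqueMap κ α = ∀ u v → u ≢ v → Coloured φ κ (α u) (α v)

  -- `S` goes into one clique and its complement into the other, so exactly the edges crossing `S`
  -- get colour `κ`.
  two-cliques-copy : ∀ κ {α β} S → CliqueMap (opp κ) α → CliqueMap (opp κ) β →
    (∀ u v → Coloured φ κ (α u) (β v)) → Half G _xor_ S → HasBalancedCopy φ G
  two-cliques-copy κ {α} {β} S α-clique β-clique across = balanced-copy κ _xor_ S (place S α β) coloured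
    where
    coloured : ∀ u v → u ≢ v → Coloured φ (choose (S u xor S v) κ) (place S α β u) (place S α β v)
    coloured u v u≢v with S u | S v
    ... | true  | true  = α-clique u v u≢v
    ... | true  | false = across u v
    ... | false | true  = Coloured-sym φ (across v u)
    ... | false | false = β-clique u v u≢v

  -- `S` goes into the clique whose colour is that of the edges across, so exactly the edges meeting
  -- `S` get colour `κ`.
  split-copy : 2 ≤ N → ∀ κ {α β} S → CliqueMap κ α → CliqueMap (opp κ) β →
    (∀ u v → col φ (α u) (β v) ≡ κ) → Half G _∨_ S → HasBalancedCopy φ G
  split-copy 2≤N κ {α} {β} S α-clique β-clique across = balanced-copy κ _∨_ S (place S α β) coloured
    where
    -- a common vertex would be joined to every other vertex of the clique β in both colours
    disjoint : ∀ u v → α u ≢ β v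
    disjoint u v αu≡βv with w , v≢w ← other 2≤N v =
      opp≢ κ (trans (sym (proj₂ (β-clique v w v≢w))) (trans (cong (λ x → col φ x (β w)) (sym αu≡βv)) (across u w)))
    across′ : ∀ u v → Coloured φ κ (α u) (β v)
    across′ u v = disjoint u v , across u v
    coloured : ∀ u v → u ≢ v → Coloured φ (choose (S u ∨ S v) κ) (place S α β u) (place S α β v)
    coloured u v u≢v with S u | S v
    ... | true  | true  = α-clique u v u≢v
    ... | true  | false = across′ u v
    ... | false | true  = Coloured-sym φ (across′ v u)
    ... | false | false = β-clique u v u≢v

  enumerate : ∀ xs → N ≤ length xs → Fin N → Fin n
  enumerate xs le u = lookup xs (F.inject≤ u le)

  enumerate-∈ : ∀ xs (le : N ≤ length xs) u → enumerate xs le u ∈ xs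
  enumerate-∈ xs le u = ∈-lookup {xs = xs} (F.inject≤ u le)

  enumerate-clique : ∀ {κ} xs (le : N ≤ length xs) → Clique φ κ xs → CliqueMap κ (enumerate xs le)
  enumerate-clique xs le clique u v u≢v =
    AllPairs-lookup (Coloured-sym φ) clique _ _ (λ eq → u≢v (F.inject≤-injective le le u v eq))

  -- Pigeonhole makes the edges across monochromatic. Whichever colour they get, `S` goes into the
  -- clique of that colour.
  opposite-cliques-copy : 2 ≤ N → ∀ {S} → Half G _∨_ S → ∀ {xs ys} →
    cliqueBound N ≤ length xs → Clique φ R xs → N + N ≤ length ys → Clique φ B ys → HasBalancedCopy φ G
  opposite-cliques-copy 2≤N {S} half-S {xs} {ys} xs-large xs-red ys-large ys-blue
    -- Only `N + N` blue vertices are kept, since each of them doubles the number of red vertices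
    -- required.
    with |ys₁|≡ ← trans (length-take (N + N) ys) (m≤n⇒m⊓n≡m ys-large)
    with homogeneous (λ x y → isR (col φ x y)) (take (N + N) ys) N xs
           (subst (λ l → 2 ^ l * N ≤ length xs) (sym |ys₁|≡) xs-large)
  ... | xs₁ , τ , N≤xs₁ , hom
      -- All vertices of `xs₁` see the kept blue vertices alike, so the colours at one vertex `x₀`
      -- decide all edges across.
      with split (λ y → isR (col φ x₀ y)) N N (take (N + N) ys) (≤-reflexive (sym |ys₁|≡))
    where
    x₀ : Fin n
    x₀ = enumerate xs₁ N≤xs₁ (F.fromℕ< (≤-trans (s≤s z≤n) 2≤N))
  ...   | inj₁ (ys₂ , σ , N≤ys₂ , red) =
    split-copy 2≤N R S (enumerate-clique xs₁ N≤xs₁ (AllPairs-resp-⊆ τ xs-red))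
      (enumerate-clique ys₂ N≤ys₂ (AllPairs-resp-⊆ (⊆-trans σ (take-⊆ (N + N) ys)) ys-blue))
      (λ u v → is-true R (trans (hom (enumerate-∈ xs₁ N≤xs₁ u) (enumerate-∈ xs₁ N≤xs₁ _)
                                     (⊆-lookup σ (enumerate-∈ ys₂ N≤ys₂ v)))
                                (All.lookup red (enumerate-∈ ys₂ N≤ys₂ v))))
      half-S
  ...   | inj₂ (ys₂ , σ , N≤ys₂ , blue) =
    split-copy 2≤N B S (enumerate-clique ys₂ N≤ys₂ (AllPairs-resp-⊆ (⊆-trans σ (take-⊆ (N + N) ys)) ys-blue))
      (enumerate-clique xs₁ N≤xs₁ (AllPairs-resp-⊆ τ xs-red))
      (λ u v → trans (colSym φ _ _)
        (is-false R (trans (hom (enumerate-∈ xs₁ N≤xs₁ v) (enumerate-∈ xs₁ N≤xs₁ _)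
                                (⊆-lookup σ (enumerate-∈ ys₂ N≤ys₂ u)))
                           (All.lookup blue (enumerate-∈ ys₂ N≤ys₂ u)))))
      half-S

  -- Ramsey on both sides of the biclique: if neither side has a clique of colour `κ`, both have one
  -- of the opposite colour, and these form the first pattern.
  copy-or-clique : ∀ κ {S} → Half G _xor_ S → ∀ K → N ≤ K → Biclique φ κ (suc (ramseyBound K K)) →
    HasBalancedCopy φ G ⊎ (∃ λ xs → length xs ≡ K × Clique φ κ xs)
  copy-or-clique κ {S} half-S K N≤K (xs , ys , xs-unique , ys-unique , xs-large , ys-large , across)
    with ramsey φ κ K K xs xs-unique (<⇒≤ xs-large) | ramsey φ κ K K ys ys-unique (<⇒≤ ys-large)
  ... | inj₁ (zs , _ , len , clique) | _ = inj₂ (zs , len , clique)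
  ... | inj₂ _ | inj₁ (zs , _ , len , clique) = inj₂ (zs , len , clique)
  ... | inj₂ (xs₁ , τ , |xs₁|≡ , xs-clique) | inj₂ (ys₁ , σ , |ys₁|≡ , ys-clique) =
    inj₁ (two-cliques-copy κ S (enumerate-clique xs₁ N≤xs₁ xs-clique) (enumerate-clique ys₁ N≤ys₁ ys-clique)
      (λ u v → across (⊆-lookup τ (enumerate-∈ xs₁ N≤xs₁ u)) (⊆-lookup σ (enumerate-∈ ys₁ N≤ys₁ v))) half-S)
    where
    N≤xs₁ = subst (N ≤_) (sym |xs₁|≡) N≤K
    N≤ys₁ = subst (N ≤_) (sym |ys₁|≡) N≤K

-- The threshold

-- This is `2 * (s + h) + 2` for `s = 4 * T` and the least `h` that `biclique` allows.
threshold : ℕ → ℕ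
threshold T = 2 * (4 * T + (2 * (2 ^ (4 * T) * T) + 4 * T + 2)) + 2

3≤threshold : ∀ T → 3 ≤ threshold T
3≤threshold T = begin
  3                      ≤⟨ m≤m+n 3 3 ⟩
  2 * 2 + 2
    ≤⟨ +-monoˡ-≤ 2 (*-monoʳ-≤ 2 (m≤n+m 2 (4 * T + (2 * (2 ^ (4 * T) * T) + 4 * T)))) ⟩
  2 * (4 * T + (2 * (2 ^ (4 * T) * T) + 4 * T) + 2) + 2
    ≡⟨ cong (λ a → 2 * a + 2) (+-assoc (4 * T) _ 2) ⟩
  threshold T            ∎
  where open ≤-Reasoning

-- The excess of `n` over the threshold is halved: the quotient `d` enlarges `h`, and the parity
-- becomes `r`.
dense⇒biclique : ∀ {n} (φ : Coloring n) κ T .{{_ : NonZero T}} → threshold T ≤ n →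
  n * n ≤ 2 * ∑[ y < n ] degreeIn φ κ y + 2 + n → Biclique φ κ T
dense⇒biclique {n} φ κ T large dense with even-or-odd (n ∸ threshold T)
... | d , inj₁ eq = biclique φ κ T (h + d) 0
  (trans (sym (m∸n+n≡m large)) (trans (cong (_+ threshold T) eq) (arith d (4 * T) h)))
  z≤n (≤-trans (3≤threshold T) large) (m≤m+n h d) dense
  where
  h = 2 * (2 ^ (4 * T) * T) + 4 * T + 2
  arith : ∀ d s h → d + d + (2 * (s + h) + 2) ≡ 2 * (s + (h + d)) + 2 + 0
  arith = solve-∀
... | d , inj₂ eq = biclique φ κ T (h + d) 1
  (trans (sym (m∸n+n≡m large)) (trans (cong (_+ threshold T) eq) (arith d (4 * T) h)))
  ≤-refl (≤-trans (3≤threshold T) large) (m≤m+n h d) dense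
  where
  h = 2 * (2 ^ (4 * T) * T) + 4 * T + 2
  arith : ∀ d s h → suc (d + d) + (2 * (s + h) + 2) ≡ 2 * (s + (h + d)) + 2 + 1
  arith = solve-∀

2*nC2+n≡n*n : ∀ n → 2 * (n C 2) + n ≡ n * n
2*nC2+n≡n*n zero    = refl
2*nC2+n≡n*n (suc n) = begin
  2 * (suc n C 2) + suc n          ≡⟨ cong (λ c → 2 * c + suc n) (nCk+nC[k+1]≡[n+1]C[k+1] n 1) ⟨
  2 * (n C 1 + n C 2) + suc n      ≡⟨ cong (λ c → 2 * (c + n C 2) + suc n) (nC1≡n n) ⟩
  2 * (n + n C 2) + suc n          ≡⟨ arith₁ n (n C 2) ⟩
  2 * (n C 2) + n + (2 * n + 1)    ≡⟨ cong (_+ (2 * n + 1)) (2*nC2+n≡n*n n) ⟩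
  n * n + (2 * n + 1)              ≡⟨ arith₂ n ⟩
  suc n * suc n                    ∎
  where
  open ≡-Reasoning
  arith₁ : ∀ n c → 2 * (n + c) + suc n ≡ 2 * c + n + (2 * n + 1)
  arith₁ = solve-∀
  arith₂ : ∀ n → n * n + (2 * n + 1) ≡ suc n * suc n
  arith₂ = solve-∀

module _ {n : ℕ} (φ : Coloring n) (κ : Color) where

  colourCount : ℕ
  colourCount = countPairs (λ i j → is κ (col φ i j))

  ∑-degreeIn : colourCount + colourCount ≡ ∑[ y < n ] degreeIn φ κ y
  ∑-degreeIn = countPairs-double (λ i j → is κ (col φ i j)) (λ i j → adjacent φ κ j i)
    (λ i j → cong (is κ) (colSym φ i j))
    (λ i → cong (λ b → not b ∧ is κ (col φ i i)) (dec-true (i F.≟ i) refl))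
    (λ i j i≢j → cong₂ (λ b c → not b ∧ is κ c) (dec-false (j F.≟ i) (λ j≡i → i≢j (sym j≡i))) (colSym φ j i))

  dense : (n C 2) / 2 ≤ colourCount → n * n ≤ 2 * ∑[ y < n ] degreeIn φ κ y + 2 + n
  dense q≤c = begin
    n * n                                        ≡⟨ 2*nC2+n≡n*n n ⟨
    2 * (n C 2) + n                              ≡⟨ cong (λ c → 2 * c + n) (m≡m%n+[m/n]*n (n C 2) 2) ⟩
    2 * ((n C 2) % 2 + (n C 2) / 2 * 2) + n
      -- Rounding down in `(n C 2) / 2` loses a remainder of at most 1, the source of the summand 2
      -- in the density bound.
      ≤⟨ +-monoˡ-≤ n (*-monoʳ-≤ 2 (+-mono-≤ (≤-pred (m%n<n (n C 2) 2)) (*-monoˡ-≤ 2 q≤c))) ⟩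
    2 * (1 + colourCount * 2) + n                ≡⟨ cong (_+ n) (arith colourCount) ⟩
    2 * (colourCount + colourCount) + 2 + n      ≡⟨ cong (λ d → 2 * d + 2 + n) ∑-degreeIn ⟩
    2 * ∑[ y < n ] degreeIn φ κ y + 2 + n        ∎
    where
    open ≤-Reasoning
    arith : ∀ c → 2 * (1 + c * 2) ≡ 2 * (c + c) + 2
    arith = solve-∀

cliqueBound-large : ∀ {N} → 1 ≤ N → N + N ≤ cliqueBound N
cliqueBound-large {N} 1≤N = ≤-trans (≤-reflexive (arith N))
  (*-monoˡ-≤ N (^-monoʳ-≤ 2 {1} {N + N} (≤-trans 1≤N (m≤m+n N N))))
  where
  arith : ∀ N → N + N ≡ 2 * N
  arith = solve-∀

bicliques⇒copy : ∀ {n} (φ : Coloring n) G → 2 ≤ order G → ∀ {S} → Half G _xor_ S → Half G _∨_ S →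
  ∀ K → order G + order G ≤ K → cliqueBound (order G) ≤ K →
  (∀ κ → Biclique φ κ (suc (ramseyBound K K))) → HasBalancedCopy φ G
bicliques⇒copy φ G 2≤N {S} half-xor half-∨ K 2N≤K bound≤K bicliques
  with copy-or-clique φ G R {S} half-xor K (≤-trans (m≤m+n _ _) 2N≤K) (bicliques R)
     | copy-or-clique φ G B {S} half-xor K (≤-trans (m≤m+n _ _) 2N≤K) (bicliques B)
... | inj₁ copy | _         = copy
... | inj₂ _    | inj₁ copy = copy
... | inj₂ (xs , |xs|≡ , red) | inj₂ (ys , |ys|≡ , blue) =
  opposite-cliques-copy φ G 2≤N {S} half-∨
    (≤-trans bound≤K (≤-reflexive (sym |xs|≡))) red (≤-trans 2N≤K (≤-reflexive (sym |ys|≡))) blue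

1≤nC2/2 : ∀ n → 3 ≤ n → 1 ≤ (n C 2) / 2
1≤nC2/2 n 3≤n = /-monoˡ-≤ 2 (*-cancelˡ-≤ {2} {n C 2} 2 (+-cancelʳ-≤ n _ _ (begin
  4 + n             ≤⟨ +-monoˡ-≤ n (≤-trans (m≤n+m 4 2) (*-monoʳ-≤ 2 3≤n)) ⟩
  2 * n + n         ≡⟨ arith n ⟩
  3 * n             ≤⟨ *-monoˡ-≤ n 3≤n ⟩
  n * n             ≡⟨ 2*nC2+n≡n*n n ⟨
  2 * (n C 2) + n   ∎)))
  where
  open ≤-Reasoning
  arith : ∀ n → 2 * n + n ≡ 3 * n
  arith = solve-∀

-- The monochromatic colouring and the conclusion

monochromatic : ∀ n → Coloring n
monochromatic n = record { col = λ _ _ → R ; colSym = λ _ _ → refl }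

-- Without blue edges a balanced copy has at most one red edge, but twice the number of edges is
-- `N * 3`, which is at least 9.
monochromatic-has-no-copy : ∀ G → 1 ≤ order G → Cubic G → ∀ n → ¬ WorksNeg n G
monochromatic-has-no-copy G 1≤N cubic n works
  with f , _ , r≤1+b , _ ← works (monochromatic n) =
  <⇒≱ (begin-strict
    countPairs red + countPairs red ≤⟨ +-mono-≤ red≤1 red≤1 ⟩
    2                               <⟨ m≤m+n 3 6 ⟩
    3 * 3                           ≤⟨ *-monoˡ-≤ 3 (3≤order G cubic 1≤N) ⟩
    N * 3                           ∎) (≤-reflexive (sym red≡))
  where
  open ≤-Reasoning
  N = order G
  red blue : Fin N → Fin N → Bool
  red u v = adj G u v ∧ true
  blue u v = adj G u v ∧ false
  ∧-true : ∀ b → b ≡ b ∧ true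
  ∧-true true  = refl
  ∧-true false = refl
  ∧-false : ∀ b → bit (b ∧ false) ≡ 0
  ∧-false true  = refl
  ∧-false false = refl
  red≡ : countPairs red + countPairs red ≡ N * 3
  red≡ = trans (countPairs-double red (adj G)
               (λ u v → cong (_∧ true) (Graph.sym G u v)) (irrefl G) (λ u v _ → ∧-true _))
               (∑∑A≡N*3 G cubic)
  blue≡0 : countPairs blue ≡ 0
  blue≡0 = m+n≡0⇒m≡0 _ (trans (countPairs-double blue blue (λ u v → cong (_∧ false) (Graph.sym G u v))
    (λ u → cong (_∧ false) (irrefl G u)) (λ _ _ _ → refl))
    (trans (∑∑-cong (λ u v → ∧-false (adj G u v)))
      (trans (sum-cong-≗ {N} (λ _ → sum-replicate-zero N)) (sum-replicate-zero N))))
  red≤1 : countPairs red ≤ 1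
  red≤1 = subst (λ b → countPairs red ≤ suc b) blue≡0 r≤1+b

theorem5p1 : (G : Graph) → 1 ≤ order G → Cubic G → Balanceable G
theorem5p1 G 1≤N cubic = threshold T , exists
  where
  N = order G
  -- `cliqueBound N` is the clique size wanted in both colours, as it is also at least `N + N`. The
  -- `suc` makes `T` nonzero.
  T = suc (ramseyBound (cliqueBound N) (cliqueBound N))
  exists : ∀ n → threshold T ≤ n → BalExists n G
  -- The witness is the largest admissible threshold: exceeding it means having at least
  -- `(n C 2) / 2` edges of each colour.
  exists n large = ((n C 2) / 2 ∸ 1 , ≤-reflexive pred+1 , works) , monochromatic-has-no-copy G 1≤N cubic n
    where
    pred+1 : suc ((n C 2) / 2 ∸ 1) ≡ (n C 2) / 2
    pred+1 = m+[n∸m]≡n (1≤nC2/2 n (≤-trans (3≤threshold T) large))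
    works : Works n G ((n C 2) / 2 ∸ 1)
    works φ r b =
      let S , half-xor , half-∨ = half-set G cubic 1≤N in
      bicliques⇒copy φ G (<⇒≤ (3≤order G cubic 1≤N)) {S} half-xor half-∨
        (cliqueBound N) (cliqueBound-large 1≤N) ≤-refl
        (λ κ → dense⇒biclique φ κ T large (dense φ κ (many κ)))
      where
      many : ∀ κ → (n C 2) / 2 ≤ colourCount φ κ
      many R = subst (_≤ #R φ) pred+1 r
      many B = subst (_≤ #B φ) pred+1 b
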